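{- Let $A$ be a set of actions. Every formal equation $e=f$ between star expressions over $A$ that is derivable in $\mathsf{cMil}$ is also derivable in $\mathsf{Mil}$. Moreover, every derivation in $\mathsf{cMil}$ with conclusion $e=f$ can be transformed effectively into a derivation in $\mathsf{Mil}$ that has the same conclusion.
   Context: **Star expressions and equational systems.** Star expressions over $A$, forming the set $StExp(A)$, are given by $e ::= 0 \mid 1 \mid a \mid (e_1+e_2)\mid (e_1\cdot e_2)\mid (e^*)$ with $a\in A$. $\equiv$ is syntactic equality. $Eq(A)$ is the set of formal equations $e=f$ with $e,f\in StExp(A)$. Immediate termination $e{\downarrow}$ is defined inductively: $1{\downarrow}$; $(e_1+e_2){\downarrow}$ if $e_1{\downarrow}$ or $e_2{\downarrow}$; $(e_1\cdot e_2){\downarrow}$ if $e_1{\downarrow}$ and $e_2{\downarrow}$; $(e^*){\downarrow}$ always. Finite sums $\sum_{i=1}^n e_i$ denote $0$ if $n=0$, $e_1$ if $n=1$, and $(\sum_{i=1}^{n-1}e_i)+e_n$ if $n>1$. An $\mathcal{EL}$-based system over $StExp(A)$ is a proof system whose formulas are the equations in $Eq(A)$ and whose rules include those of equational logic (reflexivity, symmetry, transitivity, closure under one-hole star expression contexts); it may have further axioms and rules. $e=_{\mathcal S}f$ means that $e=f$ is derivable in $\mathcal S$ without assumptions. $\mathsf{Mil}^-$ is the $\mathcal{EL}$-based system with only the rules of equational logic and the axiom schemes: $(e+f)+g=e+(f+g)$; $e+0=e$; $e+f=f+e$; $e+e=e$; $(e\cdot f)\cdot g=e\cdot(f\cdot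 g)$; $(e+f)\cdot g=e\cdot g+f\cdot g$; $1\cdot e=e$; $e\cdot 1=e$; $0\cdot e=0$; $e^*=1+e\cdot e^*$; $e^*=(1+e)^*$. For $\Gamma\subseteq Eq(A)$, $\mathsf{Mil}^-+\Gamma$ is $\mathsf{Mil}^-$ with the equations in $\Gamma$ added as axioms. Milner's system $\mathsf{Mil}$ is $\mathsf{Mil}^-$ plus the rule $\mathrm{RSP}^*$: from $e=f\cdot e+g$ infer $e=f^*\cdot g$, provided that $f{\downarrow}$ does not hold. **1-charts and LLEE.** A 1-chart is a tuple $\underline{C}=\langle V,A,1,v_s,\to,{\downarrow}\rangle$ with $V$ a finite set of vertices, $1\notin A$ the empty-step label, $v_s\in V$ the start vertex, ${\to}\subseteq V\times(A\cup\{1\})\times V$ a (finite) labeled transition relation, and ${\downarrow}\subseteq V$ the set of vertices with immediate termination. Transitions labeled in $A$ are proper; those labeled $1$ are 1-transitions. It is weakly guarded if it has no cycle of 1-transitions. A loop 1-chart is a 1-chart such that (L1) there is an infinite path from its start vertex, (L2) every infinite path from the start vertex returns to it after a positive number of transitions, (L3) only the start vertex may have immediate termination. For a vertex $v$ of $\underline C$ and a nonempty set $U$ of transitions from $v$, consider the sub-1-chart with start vertex $v$ consisting of all vertices and transitions on paths that start with a transition in $U$ and continue until $v$ is reached again (termination inherited from $\underline C$). If it is a loop 1-chart it is called a loop sub-1-chart of $\underline C$, with loop-entry transitions $U$; its remaining transitions are its loop-body transitions. Eliminating it from $\underline C$ means removing the transitions in $U$ and then all vertices and transitions that become unreachable from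 the start vertex. $\underline C$ is an LLEE-1-chart if there is a finite sequence $\underline C=\underline C_0,\dots,\underline C_n$ where $\underline C_i$ results from $\underline C_{i-1}$ by eliminating a loop sub-1-chart $L_i$ of $\underline{C}_{i-1}$ with loop-entry transitions $U_i$, $\underline C_n$ has no infinite path, and for $i<j$ no transition in $U_j$ is a loop-body transition of $L_i$ (layeredness). **Coinductive proofs.** Let $\mathcal S$ be an $\mathcal{EL}$-based system containing the axioms for associativity, commutativity and idempotency of $+$. A function $s:V\to StExp(A)$ is an $\mathcal S$-provable solution of $\underline C$ if for every $v\in V$, with $\{v\xrightarrow{\underline a_i}v_i\mid 1\le i\le n\}$ a list of all transitions from $v$, it holds that $s(v)=_{\mathcal S}\tau(v)+\sum_{i=1}^n\underline a_i\cdot s(v_i)$, where $\tau(v)\equiv 1$ if $v\in{\downarrow}$ and $\tau(v)\equiv 0$ otherwise (the label $1$ being read as the star expression $1$). A coinductive proof over $\mathcal S$ of $e_1=e_2$ is a pair $\langle\underline C,L\rangle$ with $\underline C$ a weakly guarded 1-chart and $L:V\to Eq(A)$, $L(v)=(L_1(v)=L_2(v))$, such that $L_1$ and $L_2$ are $\mathcal S$-provable solutions of $\underline C$, and $e_1\equiv L_1(v_s)$, $e_2\equiv L_2(v_s)$. It is LLEE-witnessed if $\underline C$ is an LLEE-1-chart. **The system $\mathsf{cMil}$.** For $n\in\mathbb N$ (including $0$), the rule $\mathrm{LCoProof}_n$ has premises $g_1=h_1,\dots,g_n=h_n$ together with, as $(n+1)$-th premise, an LLEE-witnessed coinductive proof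 of $e=f$ over $\mathsf{Mil}^-+\{g_1=h_1,\dots,g_n=h_n\}$, and has conclusion $e=f$. (The coinductive-proof premise is a given object that needs no further derivation.) $\mathsf{cMil}$ has the axioms of $\mathsf{Mil}^-$, the rules of equational logic, and all rules $\mathrm{LCoProof}_n$, $n\in\mathbb N$. -}

module Defs where

open import Level using (Level; suc)
open import Data.Bool.Base using (if_then_else_)
open import Data.Fin.Base as Fin using (Fin; fromℕ; inject₁)
open import Data.Fin.Properties using (_≟_)
open import Data.Fin.Subset using (Subset; _∈_; _∉_; _⊆_; ⊤; Nonempty)
open import Data.Fin.Subset.Properties using (_∈?_; ∈⊤)
open import Data.List.Base using (List; []; _∷_; [_]; map; filter; foldl; allFin)
open import Data.List.Membership.Propositional using () renaming (_∈_ to _∈ᴸ_)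
open import Data.List.Relation.Unary.All using (All)
open import Data.Nat.Base using (ℕ)
open import Data.Product.Base using (Σ; ∃; _×_; _,_; proj₁; proj₂)
open import Data.Sum.Base using (_⊎_)
open import Function.Base using (_∘_)
open import Function.Bundles using (_⇔_)
open import Function.Definitions using (Injective)
open import Relation.Binary.Construct.Closure.ReflexiveTransitive using (Star)
open import Relation.Binary.Construct.Closure.Transitive using (TransClosure)
open import Relation.Binary.PropositionalEquality.Core using (_≡_; _≢_)
open import Relation.Nullary using (¬_; does)
open import Relation.Unary using (Pred)

private
  variable
    a : Level
    A : Set a

------------------------------------------------------------------------
-- Star expressions

infix  9 _⋆
infixl 7 _·_
infixl 6 _+_

data StExp (A : Set a) : Set a where
  𝟎 𝟏     : StExp A
  act     : A → StExp A
  _+_ _·_ : StExp A → StExp A → StExp A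
  _⋆      : StExp A → StExp A

infix 5 _↓

data _↓ {A : Set a} : StExp A → Set a where
  𝟏↓  : 𝟏 ↓
  +↓ˡ : ∀ {e f} → e ↓ → (e + f) ↓
  +↓ʳ : ∀ {e f} → f ↓ → (e + f) ↓
  ·↓  : ∀ {e f} → e ↓ → f ↓ → (e · f) ↓
  ⋆↓  : ∀ {e} → (e ⋆) ↓

-- The empty sum is 𝟎, a one-element sum is its summand, and longer sums
-- associate to the left.
∑ : List (StExp A) → StExp A
∑ []       = 𝟎
∑ (e ∷ es) = foldl _+_ e es

data Context (A : Set a) : Set a where
  □         : Context A
  _+ˡ_ _·ˡ_ : Context A → StExp A → Context A
  _+ʳ_ _·ʳ_ : StExp A → Context A → Context A
  _⋆ᶜ       : Context A → Context A

_⟦_⟧ : Context A → StExp A → StExp A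
□        ⟦ e ⟧ = e
(C +ˡ f) ⟦ e ⟧ = C ⟦ e ⟧ + f
(C ·ˡ f) ⟦ e ⟧ = C ⟦ e ⟧ · f
(f +ʳ C) ⟦ e ⟧ = f + C ⟦ e ⟧
(f ·ʳ C) ⟦ e ⟧ = f · C ⟦ e ⟧
(C ⋆ᶜ)   ⟦ e ⟧ = (C ⟦ e ⟧) ⋆

------------------------------------------------------------------------
-- Proof systems based on equational logic

infix 4 _≐_

data Eq (A : Set a) : Set a where
  _≐_ : StExp A → StExp A → Eq A

-- A system is given by the instances of its axioms and rules beyond
-- equational logic: 'S ps c' is the type of rule instances with list of
-- premises ps and conclusion c, axioms being rules without premises.
System : Set a → Set (suc a)
System {a} A = List (Eq A) → Eq A → Set a

infix 3 _⊢_

data _⊢_ {A : Set a} (S : System A) : Eq A → Set a where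
  reflexivity  : ∀ {e} → S ⊢ e ≐ e
  symmetry     : ∀ {e f} → S ⊢ e ≐ f → S ⊢ f ≐ e
  transitivity : ∀ {e f g} → S ⊢ e ≐ f → S ⊢ f ≐ g → S ⊢ e ≐ g
  context      : ∀ {e f} (C : Context A) → S ⊢ e ≐ f → S ⊢ C ⟦ e ⟧ ≐ C ⟦ f ⟧
  rule         : ∀ {ps c} → S ps c → All (S ⊢_) ps → S ⊢ c

infix 3 _=[_]_

_=[_]_ : StExp A → System A → StExp A → Set _
e =[ S ] f = S ⊢ e ≐ f

Derivation : {A : Set a} → System A → Set a
Derivation S = ∃ (S ⊢_)

conclusion : {S : System A} → Derivation S → Eq A
conclusion = proj₁

data Mil⁻ {A : Set a} : System A where
  +-assoc    : ∀ {e f g} → Mil⁻ [] ((e + f) + g ≐ e + (f + g))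
  +-identity : ∀ {e}     → Mil⁻ [] (e + 𝟎 ≐ e)
  +-comm     : ∀ {e f}   → Mil⁻ [] (e + f ≐ f + e)
  +-idem     : ∀ {e}     → Mil⁻ [] (e + e ≐ e)
  ·-assoc    : ∀ {e f g} → Mil⁻ [] ((e · f) · g ≐ e · (f · g))
  ·-distribʳ : ∀ {e f g} → Mil⁻ [] ((e + f) · g ≐ e · g + f · g)
  ·-identˡ   : ∀ {e}     → Mil⁻ [] (𝟏 · e ≐ e)
  ·-identʳ   : ∀ {e}     → Mil⁻ [] (e · 𝟏 ≐ e)
  ·-zeroˡ    : ∀ {e}     → Mil⁻ [] (𝟎 · e ≐ 𝟎)
  ⋆-unfold   : ∀ {e}     → Mil⁻ [] (e ⋆ ≐ 𝟏 + e · e ⋆)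
  ⋆-𝟏+       : ∀ {e}     → Mil⁻ [] (e ⋆ ≐ (𝟏 + e) ⋆)

data Mil⁻+ {A : Set a} (Γ : Pred (Eq A) a) : System A where
  mil⁻  : ∀ {ps c} → Mil⁻ ps c → Mil⁻+ Γ ps c
  given : ∀ {c} → Γ c → Mil⁻+ Γ [] c

data Mil {A : Set a} : System A where
  mil⁻ : ∀ {ps c} → Mil⁻ ps c → Mil ps c
  RSP⋆ : ∀ {e f g} → ¬ (f ↓) → Mil [ e ≐ f · e + g ] (e ≐ f ⋆ · g)

------------------------------------------------------------------------
-- 1-charts

data Label (A : Set a) : Set a where
  proper : A → Label A
  𝟏-step : Label A

⌜_⌝ : Label A → StExp A
⌜ proper x ⌝ = act x
⌜ 𝟏-step ⌝   = 𝟏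

-- The finite sets of vertices and of transitions are enumerated without
-- repetition by Fin #vertices and Fin #transitions.
record OneChart (A : Set a) : Set a where
  field
    #vertices #transitions : ℕ

  Vertex     = Fin #vertices
  Transition = Fin #transitions

  field
    start                : Vertex
    transition           : Transition → Vertex × Label A × Vertex
    transition-injective : Injective _≡_ _≡_ transition
    terminating          : Subset #vertices

  src : Transition → Vertex
  src t = proj₁ (transition t)

  label : Transition → Label A
  label t = proj₁ (proj₂ (transition t))

  tgt : Transition → Vertex
  tgt t = proj₂ (proj₂ (transition t))

  transitionsFrom : Vertex → List Transition
  transitionsFrom v = filter (λ t → src t ≟ v) (allFin #transitions)

  τ : Vertex → StExp A
  τ v = if does (v ∈? terminating) then 𝟏 else 𝟎

  data _→₁_ : Vertex → Vertex → Set a where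
    step : ∀ t → label t ≡ 𝟏-step → src t →₁ tgt t

  WeaklyGuarded : Set a
  WeaklyGuarded = ∀ v → ¬ TransClosure _→₁_ v v

-- Sub-1-charts of a fixed 1-chart, with inherited termination.  They are
-- 1-charts in their own right; all the 1-charts that arise in eliminating
-- loops from C are of this form.
record SubChart (C : OneChart A) : Set where
  open OneChart C using (#vertices; #transitions; Vertex; src; tgt)
  field
    vertices    : Subset #vertices
    transitions : Subset #transitions
    start       : Vertex
    start∈      : start ∈ vertices
    src∈        : ∀ {t} → t ∈ transitions → src t ∈ vertices
    tgt∈        : ∀ {t} → t ∈ transitions → tgt t ∈ vertices

whole : (C : OneChart A) → SubChart C
whole C = record
  { vertices    = ⊤
  ; transitions = ⊤
  ; start       = OneChart.start C
  ; start∈      = ∈⊤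
  ; src∈        = λ _ → ∈⊤
  ; tgt∈        = λ _ → ∈⊤
  }

module _ {C : OneChart A} where
  open OneChart C hiding (start)
  open SubChart

  record InfinitePath (D : SubChart C) : Set where
    field
      at     : ℕ → Transition
      at∈    : ∀ i → at i ∈ transitions D
      linked : ∀ i → tgt (at i) ≡ src (at (ℕ.suc i))

    origin : Vertex
    origin = src (at 0)

  open InfinitePath

  record IsLoop (D : SubChart C) : Set where
    field
      infinite  : ∃ λ (π : InfinitePath D) → origin π ≡ start D
      returning : ∀ (π : InfinitePath D) → origin π ≡ start D →
                  ∃ λ i → tgt (at π i) ≡ start D
      only-start-terminates :
        ∀ {w} → w ∈ vertices D → w ∈ terminating → w ≡ start D

  -- The transitions on paths in D that start with a transition in U and
  -- continue until v is reached again.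
  data OnPath (D : SubChart C) (v : Vertex) (U : Subset #transitions) :
              Transition → Set where
    entry    : ∀ {t} → t ∈ U → OnPath D v U t
    continue : ∀ {t t′} → OnPath D v U t → tgt t ≢ v →
               t′ ∈ transitions D → src t′ ≡ tgt t → OnPath D v U t′

  -- L is the loop sub-1-chart of D with loop-entry transitions U.
  record IsLoopSubChart (D : SubChart C) (U : Subset #transitions)
                        (L : SubChart C) : Set where
    field
      nonempty     : Nonempty U
      entries⊆     : U ⊆ transitions D
      entries-from : ∀ {t} → t ∈ U → src t ≡ start L
      transitions⇔ : ∀ t → t ∈ transitions L ⇔ OnPath D (start L) U t
      vertices⇔    : ∀ w → w ∈ vertices L ⇔
                     (w ≡ start L ⊎ ∃ λ t → OnPath D (start L) U t × tgt t ≡ w)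
      isLoop       : IsLoop L

  LoopBody : SubChart C → Subset #transitions → Transition → Set
  LoopBody L U t = t ∈ transitions L × t ∉ U

  data Remaining (D : SubChart C) (U : Subset #transitions) :
                 Vertex → Vertex → Set where
    step : ∀ {t} → t ∈ transitions D → t ∉ U → Remaining D U (src t) (tgt t)

  Reachable-without : (D : SubChart C) → Subset #transitions → Vertex → Set
  Reachable-without D U w = Star (Remaining D U) (start D) w

  -- D′ arises from D by removing the transitions in U and then everything
  -- that is not reachable from the start vertex.
  record Removal (D : SubChart C) (U : Subset #transitions)
                 (D′ : SubChart C) : Set where
    field
      start≡       : start D′ ≡ start D
      transitions⇔ : ∀ t → t ∈ transitions D′ ⇔
                     (t ∈ transitions D × t ∉ U × Reachable-without D U (src t))
      vertices⇔    : ∀ w → w ∈ vertices D′ ⇔ Reachable-without D U w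

record LLEE (C : OneChart A) : Set where
  open OneChart C using (#transitions)
  field
    n       : ℕ
    chart   : Fin (ℕ.suc n) → SubChart C
    loop    : Fin n → SubChart C
    entries : Fin n → Subset #transitions
    initial : chart Fin.zero ≡ whole C
    loops   : ∀ i → IsLoopSubChart (chart (inject₁ i)) (entries i) (loop i)
    removes : ∀ i → Removal (chart (inject₁ i)) (entries i) (chart (Fin.suc i))
    final   : ¬ InfinitePath (chart (fromℕ n))
    layered : ∀ {i j} → i Fin.< j → ∀ {t} → t ∈ entries j →
              ¬ LoopBody (loop i) (entries i) t

------------------------------------------------------------------------
-- Coinductive proofs

-- The summands are listed in the order in which the transitions are
-- enumerated.  In systems with associativity, commutativity and idempotency
-- of +, every other listing gives a provably equal sum.
IsSolution : {A : Set a} (S : System A) (C : OneChart A) →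
             (OneChart.Vertex C → StExp A) → Set a
IsSolution S C s =
  ∀ v → s v =[ S ] τ v + ∑ (map (λ t → ⌜ label t ⌝ · s (tgt t)) (transitionsFrom v))
  where open OneChart C

record CoProof {A : Set a} (S : System A) (e₁ e₂ : StExp A) : Set a where
  field
    chart         : OneChart A
    weaklyGuarded : OneChart.WeaklyGuarded chart

  open OneChart chart using (Vertex; start)

  field
    L₁ L₂     : Vertex → StExp A
    solution₁ : IsSolution S chart L₁
    solution₂ : IsSolution S chart L₂
    start₁    : e₁ ≡ L₁ start
    start₂    : e₂ ≡ L₂ start

record LLEECoProof {A : Set a} (S : System A) (e₁ e₂ : StExp A) : Set a where
  field
    coProof : CoProof S e₁ e₂
    llee    : LLEE (CoProof.chart coProof)

-- The length of Γ is the index n of the rule LCoProof_n.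
data cMil {A : Set a} : System A where
  mil⁻     : ∀ {ps c} → Mil⁻ ps c → cMil ps c
  LCoProof : ∀ {e f} (Γ : List (Eq A)) →
             LLEECoProof (Mil⁻+ (_∈ᴸ Γ)) e f → cMil Γ (e ≐ f)

{-# OPTIONS --safe #-}
-- Two Mil-provable solutions of an LLEE-1-chart are provably equal in Mil:
-- along the elimination of loops, every vertex v of the current chart keeps an
-- equation s v = f · s v + (τ v + exits), valid for all solutions s with one
-- and the same f, whose exits run over transitions of the current chart only.
-- In a loop sub-1-chart at v the part that avoids v is acyclic, so that RSP⋆
-- expresses each of its vertices w as s w = e · s v; eliminating the loop then
-- moves its entry transitions from the exits of v into the coefficient f.
-- Weak guardedness keeps f non-terminating.  The last chart is acyclic, and
-- there RSP⋆ determines solutions completely.  Hence LCoProof is admissible in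
-- Mil.
module Submission where

open import Defs
open import Level using (Level)
open import Algebra.Bundles using (CommutativeMonoid)
import Algebra.Properties.CommutativeSemigroup as CommutativeSemigroupProperties
open import Data.Empty using (⊥)
open import Data.Fin.Base using (fromℕ)
open import Data.Fin.Induction using (<-weakInduction; spo-noetherian)
open import Data.Fin.Properties using (_≟_)
open import Data.Fin.Subset using (_∈_; _∉_)
open import Data.Fin.Subset.Properties using (_∈?_; ∈⊤)
open import Data.List.Base using (List; []; _∷_; map; foldl; allFin)
open import Data.List.Relation.Unary.All as All using (All; []; _∷_)
open import Data.List.Relation.Unary.All.Properties using (all-filter)
open import Data.Nat.Base using (ℕ; zero; suc)
open import Data.Product.Base using (Σ-syntax; ∃-syntax; _×_; _,_; proj₁; proj₂)
open import Data.Sum.Base using (inj₁; inj₂)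
open import Function.Base using (flip; _∘_)
open import Function.Bundles using (module Equivalence)
open import Induction.WellFounded using (Acc; acc; WellFounded; module Subrelation)
open import Relation.Binary.Construct.Closure.ReflexiveTransitive using (Star; ε; _◅_)
open import Relation.Binary.Construct.Closure.Transitive
  using (TransClosure; [_]; _∷_; transitive)
open import Relation.Binary.PropositionalEquality
  using (_≡_; _≢_; refl; sym; trans; cong; subst; isEquivalence; resp₂)
import Relation.Binary.Reasoning.Setoid as SetoidReasoning
open import Relation.Nullary using (¬_; yes; no; contradiction)

private
  variable
    a : Level
    A : Set a

-- Translation of derivations between systems.

module _ {S T : System A} (admissible : ∀ {ps c} → S ps c → All (T ⊢_) ps → T ⊢ c) where

  -- Each rule application is replaced by a derivation in `T` built from the premises already
  -- translated; `⊢-fold*` makes the recursion through the premise list structural.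
  ⊢-fold : ∀ {c} → S ⊢ c → T ⊢ c
  ⊢-fold* : ∀ {cs} → All (S ⊢_) cs → All (T ⊢_) cs

  ⊢-fold reflexivity         = reflexivity
  ⊢-fold (symmetry d)        = symmetry (⊢-fold d)
  ⊢-fold (transitivity d d′) = transitivity (⊢-fold d) (⊢-fold d′)
  ⊢-fold (context C d)       = context C (⊢-fold d)
  ⊢-fold (rule r ds)         = admissible r (⊢-fold* ds)

  ⊢-fold* []       = []
  ⊢-fold* (d ∷ ds) = ⊢-fold d ∷ ⊢-fold* ds

module _ {A : Set a} where

  -- Equational reasoning in `Mil`.

  infix 4 _≈_

  _≈_ : StExp A → StExp A → Set a
  e ≈ f = e =[ Mil ] f

  axiom : ∀ {c : Eq A} → Mil⁻ [] c → Mil ⊢ c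
  axiom r = rule (mil⁻ r) []

  +-cong : ∀ {e e′ f f′} → e ≈ e′ → f ≈ f′ → e + f ≈ e′ + f′
  +-cong {e′ = e′} {f} p q =
    transitivity (context (□ +ˡ f) p) (context (e′ +ʳ □) q)

  ·-congʳ : ∀ {e f g} → e ≈ f → e · g ≈ f · g
  ·-congʳ {g = g} = context (□ ·ˡ g)

  ·-congˡ : ∀ {e f g} → e ≈ f → g · e ≈ g · f
  ·-congˡ {g = g} = context (g ·ʳ □)

  +-commutativeMonoid : CommutativeMonoid a a
  +-commutativeMonoid = record
    { Carrier = StExp A
    ; _≈_     = _≈_
    ; _∙_     = _+_
    ; ε       = 𝟎
    ; isCommutativeMonoid = record
      { isMonoid = record
        { isSemigroup = record
          { isMagma = record
            { isEquivalence = record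
              { refl  = reflexivity
              ; sym   = symmetry
              ; trans = transitivity
              }
            ; ∙-cong = +-cong
            }
          ; assoc = λ _ _ _ → axiom +-assoc
          }
        ; identity = (λ _ → transitivity (axiom +-comm) (axiom +-identity))
                   , (λ _ → axiom +-identity)
        }
      ; comm = λ _ _ → axiom +-comm
      }
    }

  open CommutativeMonoid +-commutativeMonoid using (setoid; identityˡ; commutativeSemigroup)
  open CommutativeSemigroupProperties commutativeSemigroup using (x∙yz≈y∙xz)
  open SetoidReasoning setoid hiding (start)

  ⌜⌝↓⇒𝟏-step : ∀ {l : Label A} → ⌜ l ⌝ ↓ → l ≡ 𝟏-step
  ⌜⌝↓⇒𝟏-step {l = 𝟏-step} 𝟏↓ = refl

  -- Cycles and infinite paths in a 1-chart.

  module _ (C : OneChart A) where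
    open OneChart C hiding (start)
    open SubChart
    open InfinitePath

    Edge : (Transition → Set) → Vertex → Vertex → Set
    Edge P u w = ∃[ t ] P t × src t ≡ u × tgt t ≡ w

    module _ {P : Transition → Set} {v : Vertex} where
      private
        Walk : Set
        Walk = ∃[ u ] TransClosure (Edge P) u v

        first : Walk → Transition
        first (_ , [ t , _ ])     = t
        first (_ , ((t , _) ∷ _)) = t

        first-P : ∀ w → P (first w)
        first-P (_ , [ _ , p , _ ])     = p
        first-P (_ , ((_ , p , _) ∷ _)) = p

        first-src : ∀ w → src (first w) ≡ proj₁ w
        first-src (_ , [ _ , _ , q , _ ])     = q
        first-src (_ , ((_ , _ , q , _) ∷ _)) = q

      -- The path runs round the cycle forever. Its state, a `Walk`, is what remains of the current
      -- round; once that is used up, the next round starts.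
      cycle⇒infinite : (D : SubChart C) → (∀ {t} → P t → t ∈ transitions D) →
                       TransClosure (Edge P) v v →
                       Σ[ π ∈ InfinitePath D ] origin π ≡ v × (∀ i → P (at π i))
      cycle⇒infinite D P⊆D c =
        record { at = first ∘ walk ; at∈ = P⊆D ∘ first-P ∘ walk ; linked = next-linked ∘ walk } ,
        first-src (v , c) , first-P ∘ walk
        where
        next : Walk → Walk
        next (_ , [ _ ])   = v , c
        next (_ , (_ ∷ w)) = _ , w

        next-linked : ∀ w → tgt (first w) ≡ src (first (next w))
        next-linked (_ , [ _ , _ , _ , q ])     = trans q (sym (first-src (v , c)))
        next-linked (_ , ((_ , _ , _ , q) ∷ w)) = trans q (sym (first-src (_ , w)))

        walk : ℕ → Walk
        walk zero    = v , c
        walk (suc i) = next (walk i)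

    -- Without cycles the transitive closure is a strict partial order on a finite set, hence
    -- noetherian. The relation is flipped because later recursions pass from a vertex to its
    -- successors.
    acyclic⇒wellFounded : ∀ {P} → (∀ {v} → ¬ TransClosure (Edge P) v v) →
                          WellFounded (flip (Edge P))
    acyclic⇒wellFounded acyclic = Subrelation.wellFounded [_] (spo-noetherian (record
      { isEquivalence = isEquivalence
      ; irrefl        = λ { refl → acyclic }
      ; trans         = transitive _
      ; <-resp-≈      = resp₂ _
      }))

    -- Sums over transitions and guarded equations.

    -- Nested to the right and ended by `𝟎`, unlike `∑`, so that proofs by induction on the list
    -- treat one transition at a time.
    outgoing : (Vertex → StExp A) → List Transition → StExp A
    outgoing s []       = 𝟎
    outgoing s (t ∷ ts) = ⌜ label t ⌝ · s (tgt t) + outgoing s ts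

    foldl≈+outgoing : ∀ e s ts →
      foldl _+_ e (map (λ t → ⌜ label t ⌝ · s (tgt t)) ts) ≈ e + outgoing s ts
    foldl≈+outgoing e s []       = symmetry (axiom +-identity)
    foldl≈+outgoing e s (t ∷ ts) = transitivity (foldl≈+outgoing _ s ts) (axiom +-assoc)

    ∑≈outgoing : ∀ s ts → ∑ (map (λ t → ⌜ label t ⌝ · s (tgt t)) ts) ≈ outgoing s ts
    ∑≈outgoing s []       = reflexivity
    ∑≈outgoing s (t ∷ ts) = foldl≈+outgoing _ s ts

    τ-nonterminating : ∀ {v} → v ∉ terminating → τ v ≡ 𝟎
    τ-nonterminating {v} v∉ with v ∈? terminating
    ... | yes v∈ = contradiction v∈ v∉
    ... | no _   = refl

    Solution : (Vertex → StExp A) → Set a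
    Solution = IsSolution Mil C

    TransitionOf : SubChart C → Vertex → Transition → Set
    TransitionOf D v t = t ∈ transitions D × src t ≡ v

    record GuardedEquation (D : SubChart C) (v : Vertex) : Set a where
      field
        coefficient : StExp A
        guarded     : ¬ (coefficient ↓)
        exits       : List Transition
        exits-of    : All (TransitionOf D v) exits
        holds       : ∀ {s} → Solution s → s v ≈ coefficient · s v + (τ v + outgoing s exits)

      solved : ∀ {s} → Solution s → s v ≈ coefficient ⋆ · (τ v + outgoing s exits)
      solved sol = rule (RSP⋆ guarded) (holds sol ∷ [])

    open GuardedEquation

    GuardedEquations : SubChart C → Set a
    GuardedEquations D = ∀ {v} → v ∈ vertices D → GuardedEquation D v

    whole-equations : GuardedEquations (whole C)
    whole-equations {v} _ = record
      -- No loop has been eliminated yet, so all transitions are still exits.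
      { coefficient = 𝟎
      ; guarded     = λ ()
      ; exits       = transitionsFrom v
      ; exits-of    = All.map (∈⊤ ,_) (all-filter (λ t → src t ≟ v) (allFin #transitions))
      ; holds       = λ {s} sol → begin
          s v                                               ≈⟨ transitivity (sol v) (+-cong reflexivity (∑≈outgoing s (transitionsFrom v))) ⟩
          τ v + outgoing s (transitionsFrom v)              ≈⟨ identityˡ _ ⟨
          𝟎 + (τ v + outgoing s (transitionsFrom v))        ≈⟨ +-cong (axiom ·-zeroˡ) reflexivity ⟨
          𝟎 · s v + (τ v + outgoing s (transitionsFrom v))  ∎
      }

    -- The implication from e ↓ to a path of 1-transitions is what turns weak
    -- guardedness into the side condition of RSP⋆.
    record Factors (w v : Vertex) : Set a where
      field
        factor   : StExp A
        silent   : factor ↓ → Star _→₁_ w v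
        factor-· : ∀ {s} → Solution s → s w ≈ factor · s v

    open Factors

    -- A product terminates only if both factors do, and among the labels only `𝟏-step` denotes a
    -- terminating expression.
    silent-step : ∀ {t v} (F : Factors (tgt t) v) →
                  (⌜ label t ⌝ · factor F) ↓ → src t →₁ tgt t × Star _→₁_ (tgt t) v
    silent-step F (·↓ l↓ e↓) = step _ (⌜⌝↓⇒𝟏-step l↓) , silent F e↓

    ◅⇒⁺ : ∀ {u v w} → u →₁ v → Star _→₁_ v w → TransClosure _→₁_ u w
    ◅⇒⁺ r ε         = [ r ]
    ◅⇒⁺ r (r′ ◅ rs) = r ∷ ◅⇒⁺ r′ rs

    cons-factor : ∀ {t v ts g s} (F : Factors (tgt t) v) → Solution s →
                  outgoing s ts ≈ g · s v →
                  outgoing s (t ∷ ts) ≈ (⌜ label t ⌝ · factor F + g) · s v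
    cons-factor F sol eq = transitivity
      (+-cong (transitivity (·-congˡ (factor-· F sol)) (symmetry (axiom ·-assoc))) eq)
      (symmetry (axiom ·-distribʳ))

    -- Elimination of one loop sub-1-chart.

    module Loop {D U L} (loopSub : IsLoopSubChart D U L) (eqn : GuardedEquations D)
                (weaklyGuarded : WeaklyGuarded) where
      open IsLoopSubChart loopSub renaming (transitions⇔ to L-transitions; vertices⇔ to L-vertices)
      open IsLoop isLoop
      open Equivalence

      private
        v : Vertex
        v = start L

        Avoiding : Transition → Set
        Avoiding t = t ∈ transitions L × src t ≢ v × tgt t ≢ v

      -- Following the path to `t` backwards to its entry transition and prepending it to `π` gives
      -- an infinite path of `L` from `v` that never comes back, against `returning`.
      no-escape : ∀ {t} → OnPath D v U t → tgt t ≢ v →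
                  (π : InfinitePath L) → origin π ≡ tgt t → (∀ i → tgt (at π i) ≢ v) → ⊥
      no-escape {t} p t≢ π o avoids = extend p
        where
        π′ : InfinitePath L
        π′ = record
          { at     = λ { zero → t ; (suc i) → at π i }
          ; at∈    = λ { zero → L-transitions _ .from p ; (suc i) → at∈ π i }
          ; linked = λ { zero → sym o ; (suc i) → linked π i }
          }

        avoids′ : ∀ i → tgt (at π′ i) ≢ v
        avoids′ zero    = t≢
        avoids′ (suc i) = avoids i

        extend : OnPath D v U t → ⊥
        extend (entry t∈U) with returning π′ (entries-from t∈U)
        ... | i , back = avoids′ i back
        extend (continue q q≢ _ link) = no-escape q q≢ π′ link avoids′

      -- Such a cycle would give an infinite path avoiding `v`. Its origin differs from `v`, so it
      -- is the target of a transition on a path from `U`, and `no-escape` applies.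
      avoiding-acyclic : ∀ {w} → ¬ TransClosure (Edge Avoiding) w w
      avoiding-acyclic c with cycle⇒infinite L proj₁ c
      ... | π , _ , avoids
        with L-vertices _ .to (src∈ L (at∈ π 0))
      ... | inj₁ w≡v         = proj₁ (proj₂ (avoids 0)) w≡v
      ... | inj₂ (t , p , q) =
        no-escape p (λ t≡v → proj₁ (proj₂ (avoids 0)) (trans (sym q) t≡v))
                  π (sym q) (proj₂ ∘ proj₂ ∘ avoids)

      onPath-∈ : ∀ {t} → OnPath D v U t → t ∈ transitions D
      onPath-∈ (entry t∈U)          = entries⊆ t∈U
      onPath-∈ (continue _ _ t∈D _) = t∈D

      -- Recursion along the edges that avoid `v`: the exits of `w` have factors already, `τ w` is
      -- `𝟎` by (L3), and `RSP⋆` removes `s w` from the right-hand side.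
      factors : ∀ {w} → Acc (flip (Edge Avoiding)) w → w ∈ vertices L → Factors w v
      factors {w} (acc rec) w∈L with w ≟ v
      ... | yes refl = record
        { factor = 𝟏 ; silent = λ _ → ε ; factor-· = λ _ → symmetry (axiom ·-identˡ) }
      ... | no w≢v with L-vertices w .to w∈L
      ...   | inj₁ w≡v = contradiction w≡v w≢v
      ...   | inj₂ (t₀ , p , refl) = record
        { factor   = coefficient E ⋆ · proj₁ sum
        -- The iteration always terminates, so only the sum over the exits tells whether `v` is
        -- reachable by 1-transitions.
        ; silent   = λ { (·↓ _ g↓) → proj₁ (proj₂ sum) g↓ }
        ; factor-· = λ {s} sol → begin
            s w                                            ≈⟨ solved E sol ⟩
            coefficient E ⋆ · (τ w + outgoing s (exits E))  ≡⟨ cong (λ x → coefficient E ⋆ · (x + outgoing s (exits E))) (τ-nonterminating (w≢v ∘ only-start-terminates w∈L)) ⟩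
            coefficient E ⋆ · (𝟎 + outgoing s (exits E))    ≈⟨ ·-congˡ (identityˡ _) ⟩
            coefficient E ⋆ · outgoing s (exits E)          ≈⟨ ·-congˡ (proj₂ (proj₂ sum) sol) ⟩
            coefficient E ⋆ · (proj₁ sum · s v)             ≈⟨ axiom ·-assoc ⟨
            (coefficient E ⋆ · proj₁ sum) · s v             ∎
        }
        where
        E : GuardedEquation D w
        E = eqn (tgt∈ D (onPath-∈ p))

        factors-tgt : ∀ {t} → TransitionOf D w t → Factors (tgt t) v
        factors-tgt {t} (t∈D , t-src) with tgt t ≟ v
        -- A transition back to `v` is not an `Avoiding` edge, so the recursion stops here.
        ... | yes t≡v = record
          { factor   = 𝟏
          ; silent   = λ _ → subst (Star _→₁_ (tgt t)) t≡v ε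
          ; factor-· = λ {s} _ → subst (λ u → s (tgt t) ≈ 𝟏 · s u) t≡v (symmetry (axiom ·-identˡ))
          }
        ... | no t≢v = factors (rec (t , (t∈L , w≢v ∘ trans (sym t-src) , t≢v) , t-src , refl))
                               (tgt∈ L t∈L)
          where
          t∈L : t ∈ transitions L
          -- The path that reaches `w` continues along `t`, because `w` is not `v`.
          t∈L = L-transitions t .from (continue p w≢v t∈D t-src)

        sum-factors : ∀ {ts} → All (TransitionOf D w) ts →
                      ∃[ g ] (g ↓ → Star _→₁_ w v) × (∀ {s} → Solution s → outgoing s ts ≈ g · s v)
        sum-factors [] = 𝟎 , (λ ()) , λ _ → symmetry (axiom ·-zeroˡ)
        sum-factors {t ∷ ts} (o ∷ os) with sum-factors os
        ... | g , g-silent , g-eq =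
          ⌜ label t ⌝ · factor F + g , silent′ , λ sol → cons-factor {ts = ts} F sol (g-eq sol)
          where
          F = factors-tgt o

          silent′ : (⌜ label t ⌝ · factor F + g) ↓ → Star _→₁_ w v
          silent′ (+↓ˡ e↓) with silent-step {t} F e↓
          ... | r , rs = subst (λ u → Star _→₁_ u v) (proj₂ o) (r ◅ rs)
          silent′ (+↓ʳ g↓) = g-silent g↓

        sum = sum-factors (exits-of E)

      entry-factors : ∀ {t} → t ∈ U → Factors (tgt t) v
      entry-factors t∈U = factors (acyclic⇒wellFounded avoiding-acyclic _)
                                  (tgt∈ L (L-transitions _ .from (entry t∈U)))

      -- All entries start at `v`. Hence at any other vertex nothing is extracted and `g` is `𝟎`,
      -- while at `v` each entry in the list contributes its label times the factor of its target.
      extract-entries : ∀ {w ts} → All (TransitionOf D w) ts →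
        ∃[ g ] ∃[ ts′ ] ¬ (g ↓) × All (λ t → TransitionOf D w t × t ∉ U) ts′ ×
          (∀ {s} → Solution s → outgoing s ts ≈ g · s w + outgoing s ts′)
      extract-entries [] =
        𝟎 , [] , (λ ()) , [] ,
        λ _ → symmetry (transitivity (axiom +-identity) (axiom ·-zeroˡ))
      extract-entries {w} {t ∷ ts} (o ∷ os) with extract-entries os | t ∈? U
      ... | g , ts′ , g-guarded , os′ , eq | no t∉U =
        g , t ∷ ts′ , g-guarded , (o , t∉U) ∷ os′ ,
        λ sol → transitivity (+-cong reflexivity (eq sol)) (x∙yz≈y∙xz _ _ _)
      ... | g , ts′ , g-guarded , os′ , eq | yes t∈U =
        ⌜ label t ⌝ · factor F + g , ts′ , guarded′ , os′ ,
        λ {s} sol → begin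
          ⌜ label t ⌝ · s (tgt t) + outgoing s ts                        ≈⟨ +-cong (·-congˡ (factor-· F sol)) (eq sol) ⟩
          ⌜ label t ⌝ · (factor F · s v) + (g · s w + outgoing s ts′)     ≡⟨ cong (λ u → ⌜ label t ⌝ · (factor F · s u) + (g · s w + outgoing s ts′)) v≡w ⟩
          ⌜ label t ⌝ · (factor F · s w) + (g · s w + outgoing s ts′)     ≈⟨ axiom +-assoc ⟨
          (⌜ label t ⌝ · (factor F · s w) + g · s w) + outgoing s ts′     ≈⟨ +-cong (+-cong (axiom ·-assoc) reflexivity) reflexivity ⟨
          ((⌜ label t ⌝ · factor F) · s w + g · s w) + outgoing s ts′     ≈⟨ +-cong (axiom ·-distribʳ) reflexivity ⟨
          (⌜ label t ⌝ · factor F + g) · s w + outgoing s ts′             ∎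
        where
        F = entry-factors t∈U

        v≡w : v ≡ w
        v≡w = trans (sym (entries-from t∈U)) (proj₂ o)

        guarded′ : ¬ ((⌜ label t ⌝ · factor F + g) ↓)
        -- Termination would make the entry a 1-transition and close it to a cycle of 1-transitions
        -- through `v`.
        guarded′ (+↓ˡ e↓) with silent-step {t} F e↓
        ... | r , rs =
          weaklyGuarded _ (subst (TransClosure _→₁_ (src t)) (sym (entries-from t∈U)) (◅⇒⁺ r rs))
        guarded′ (+↓ʳ g↓) = g-guarded g↓

      module _ {D′} (removal : Removal D U D′) where
        open Removal removal

        remaining-∈ : ∀ {u w} → Star (Remaining D U) u w → u ∈ vertices D → w ∈ vertices D
        remaining-∈ ε                u∈ = u∈
        remaining-∈ (step t∈ _ ◅ rs) _  = remaining-∈ rs (tgt∈ D t∈)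

        removal-equations : GuardedEquations D′
        removal-equations {w} w∈ = record
          { coefficient = coefficient E + g
          ; guarded     = λ { (+↓ˡ f↓) → guarded E f↓ ; (+↓ʳ g↓) → g-guarded g↓ }
          ; exits       = ts′
          ; exits-of    = All.map keep os′
          ; holds       = λ {s} sol → begin
              s w                                                         ≈⟨ holds E sol ⟩
              coefficient E · s w + (τ w + outgoing s (exits E))           ≈⟨ +-cong reflexivity (+-cong reflexivity (eq sol)) ⟩
              coefficient E · s w + (τ w + (g · s w + outgoing s ts′))     ≈⟨ +-cong reflexivity (x∙yz≈y∙xz _ _ _) ⟩
              coefficient E · s w + (g · s w + (τ w + outgoing s ts′))     ≈⟨ axiom +-assoc ⟨
              (coefficient E · s w + g · s w) + (τ w + outgoing s ts′)     ≈⟨ +-cong (axiom ·-distribʳ) reflexivity ⟨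
              (coefficient E + g) · s w + (τ w + outgoing s ts′)           ∎
          }
          where
          reachable : Reachable-without D U w
          reachable = vertices⇔ w .to w∈

          E : GuardedEquation D w
          E = eqn (remaining-∈ reachable (start∈ D))

          extracted = extract-entries (exits-of E)
          g         = proj₁ extracted
          ts′       = proj₁ (proj₂ extracted)
          g-guarded = proj₁ (proj₂ (proj₂ extracted))
          os′       = proj₁ (proj₂ (proj₂ (proj₂ extracted)))
          eq        = proj₂ (proj₂ (proj₂ (proj₂ extracted)))

          keep : ∀ {t} → TransitionOf D w t × t ∉ U → TransitionOf D′ w t
          keep {t} ((t∈D , t-src) , t∉U) =
            -- The exits left over lie outside `U` and start at the reachable vertex `w`, so they
            -- survive the removal.
            transitions⇔ t .from
              (t∈D , t∉U , subst (Reachable-without D U) (sym t-src) reachable) ,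
            t-src

    -- Uniqueness of solutions after the last elimination.

    module _ {D : SubChart C} (finite : ¬ InfinitePath D) (eqn : GuardedEquations D)
             {s₁ s₂} (sol₁ : Solution s₁) (sol₂ : Solution s₂) where

      -- By `solved`, both solutions at a vertex are the same expression in their values at the
      -- targets of its exits; those agree by recursion, which is well-founded since a cycle would
      -- yield an infinite path.
      solutions-agree : ∀ {v} → v ∈ vertices D → s₁ v ≈ s₂ v
      solutions-agree v∈ = go (acyclic⇒wellFounded acyclic _) v∈
        where
        acyclic : ∀ {w} → ¬ TransClosure (Edge (_∈ transitions D)) w w
        acyclic c = finite (proj₁ (cycle⇒infinite D (λ t∈ → t∈) c))

        go : ∀ {w} → Acc (flip (Edge (_∈ transitions D))) w → w ∈ vertices D → s₁ w ≈ s₂ w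
        go {w} (acc rec) w∈ = begin
          s₁ w                                             ≈⟨ solved E sol₁ ⟩
          coefficient E ⋆ · (τ w + outgoing s₁ (exits E))   ≈⟨ ·-congˡ (+-cong reflexivity (agree (exits-of E))) ⟩
          coefficient E ⋆ · (τ w + outgoing s₂ (exits E))   ≈⟨ solved E sol₂ ⟨
          s₂ w                                             ∎
          where
          E = eqn w∈

          agree : ∀ {ts} → All (TransitionOf D w) ts → outgoing s₁ ts ≈ outgoing s₂ ts
          agree []              = reflexivity
          agree ((t∈ , q) ∷ os) =
            +-cong (·-congˡ (go (rec (_ , t∈ , q , refl)) (tgt∈ D t∈))) (agree os)

    -- Induction along the elimination sequence.

    module _ (weaklyGuarded : WeaklyGuarded) (llee : LLEE C) where
      open LLEE llee

      elimination-equations : ∀ i → GuardedEquations (chart i)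
      elimination-equations = <-weakInduction (λ i → GuardedEquations (chart i))
        (subst GuardedEquations (sym initial) whole-equations)
        (λ i eqn → Loop.removal-equations (loops i) eqn weaklyGuarded (removes i))

      elimination-start : ∀ i → start (chart i) ≡ OneChart.start C
      elimination-start = <-weakInduction (λ i → start (chart i) ≡ OneChart.start C)
        (cong start initial)
        (λ i → trans (Removal.start≡ (removes i)))

      LLEE-solutions-agree : ∀ {s₁ s₂} → Solution s₁ → Solution s₂ →
                             s₁ (OneChart.start C) ≈ s₂ (OneChart.start C)
      LLEE-solutions-agree sol₁ sol₂ =
        solutions-agree final (elimination-equations (fromℕ n)) sol₁ sol₂
          (subst (_∈ vertices (chart (fromℕ n))) (elimination-start (fromℕ n))
                 (start∈ (chart (fromℕ n))))

  -- Admissibility of `LCoProof` in `Mil`.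

  LLEECoProof⇒≈ : ∀ {e f} → LLEECoProof Mil e f → e ≈ f
  LLEECoProof⇒≈ record { coProof = record
      { chart = C ; weaklyGuarded = wg ; solution₁ = sol₁ ; solution₂ = sol₂
      ; start₁ = refl ; start₂ = refl } ; llee = llee } =
    LLEE-solutions-agree C wg llee sol₁ sol₂

  -- Only the two solution conditions mention the proof system.
  mapLLEECoProof : ∀ {S T : System A} {e f} → (∀ {c} → S ⊢ c → T ⊢ c) →
               LLEECoProof S e f → LLEECoProof T e f
  mapLLEECoProof S⇒T p = record
    { coProof = record
      { chart         = chart
      ; weaklyGuarded = weaklyGuarded
      ; L₁            = L₁
      ; L₂            = L₂
      ; solution₁     = S⇒T ∘ solution₁
      ; solution₂     = S⇒T ∘ solution₂
      ; start₁        = start₁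
      ; start₂        = start₂
      }
    ; llee = LLEECoProof.llee p
    }
    where open CoProof (LLEECoProof.coProof p)

  cMil⇒Mil : ∀ {c : Eq A} → cMil ⊢ c → Mil ⊢ c
  cMil⇒Mil = ⊢-fold λ where
    (mil⁻ r)       ds → rule (mil⁻ r) ds
    -- The premises `ds` have already been translated, so every equation of `Γ` is derivable in
    -- `Mil` and the coinductive proof becomes one over `Mil`.
    (LCoProof Γ p) ds → LLEECoProof⇒≈ (mapLLEECoProof
      (⊢-fold λ where
        (mil⁻ r)    ds′ → rule (mil⁻ r) ds′
        (given c∈Γ) _   → All.lookup ds c∈Γ)
      p)

theorem5p9 : ∀ {a : Level} (A : Set a) →
    (∀ (e f : StExp A) → e =[ cMil ] f → e =[ Mil ] f)
    × (Σ[ T ∈ (Derivation (cMil {A = A}) → Derivation (Mil {A = A})) ]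
    (∀ (D : Derivation cMil) → conclusion (T D) ≡ conclusion D))
theorem5p9 A =
  (λ _ _ → cMil⇒Mil) , (λ (c , d) → c , cMil⇒Mil d) , λ _ → refl
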